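{- Let $p$ be a prime and $q=p^r$. Suppose there is an integer $b$ with $1<b<p-1$ and $\gcd(b,q-1)=1$. Then for every $n\ge 1$ there exists a local permutation polynomial $F\in\mathbb{F}_p[x_1,\dots,x_n]$ (viewed over $\mathbb{F}_q$) of degree $n(q-2)$.
   Context: $\mathbb{F}_q$ is the finite field with $q=p^r$ elements. A polynomial $f\in\mathbb{F}_q[x_1,\dots,x_n]$ is a local permutation polynomial (LPP) if, for each $i$ and each choice of the other coordinates $(a_j)_{j\ne i}\in\mathbb{F}_q^{n-1}$, the univariate polynomial in $x_i$ obtained by fixing $x_j=a_j$ for $j\ne i$ induces a bijection of $\mathbb{F}_q$. Polynomials are reduced (degree $<q$ in each variable), and degree means total degree. -}

module Defs where

open import Algebra.Bundles using (CommutativeRing; Semiring)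
open import Algebra.Morphism.Structures using (module RingMorphisms)
import Algebra.Definitions.RawSemiring as RawSemiringOps
open import Data.Fin using (Fin; toℕ)
open import Data.Nat using (ℕ; zero; suc; _≤_)
open import Data.Product using (∃; _×_)
open import Data.Vec as Vec using (Vec; []; _∷_; _[_]≔_)
open import Function using (_∘_)
open import Function.Bundles using (Inverse)
open import Function.Definitions using (Bijective)
open import Level using (Level; _⊔_) renaming (suc to lsuc)
open import Relation.Binary.PropositionalEquality as ≡ using (_≡_)
open import Relation.Nullary using (¬_)

record FiniteField (c ℓ : Level) (q : ℕ) : Set (lsuc (c ⊔ ℓ)) where
  field
    commutativeRing : CommutativeRing c ℓ
  open CommutativeRing commutativeRing public
  field
    0≉1         : ¬ (0# ≈ 1#)
    inverse     : ∀ x → ¬ (x ≈ 0#) → ∃ λ y → x * y ≈ 1#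
    enumeration : Inverse setoid (≡.setoid (Fin q))

-- Ring homomorphisms preserve 1#, so between finite fields of p and p ^ r
-- elements this is the embedding of the prime field.
record Embedding {c₁ ℓ₁ c₂ ℓ₂ p q} (E : FiniteField c₁ ℓ₁ p) (K : FiniteField c₂ ℓ₂ q)
                 : Set (c₁ ⊔ ℓ₁ ⊔ c₂ ⊔ ℓ₂) where
  private
    module E = FiniteField E
    module K = FiniteField K
  open RingMorphisms E.rawRing K.rawRing using (IsRingHomomorphism)
  field
    ⟦_⟧                : E.Carrier → K.Carrier
    isRingHomomorphism : IsRingHomomorphism ⟦_⟧

-- Exponent vectors (e₁ , … , eₙ) with every eᵢ < q.
Exponents : ℕ → ℕ → Set
Exponents q n = Vec (Fin q) n

totalDegree : ∀ {q n} → Exponents q n → ℕ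
totalDegree e = Vec.sum (Vec.map toℕ e)

-- A polynomial in n variables of degree < q in each of them, given by its
-- coefficients.  The bound q need not be the size of the coefficient field m,
-- so that reduced polynomials over 𝔽_q may have coefficients in 𝔽_p.
ReducedPoly : ∀ {c ℓ m} → FiniteField c ℓ m → (q n : ℕ) → Set c
ReducedPoly K q n = Exponents q n → FiniteField.Carrier K

extendScalars : ∀ {c₁ ℓ₁ c₂ ℓ₂ p m q n} {E : FiniteField c₁ ℓ₁ p} {K : FiniteField c₂ ℓ₂ m} →
                Embedding E K → ReducedPoly E q n → ReducedPoly K q n
extendScalars ι f = Embedding.⟦_⟧ ι ∘ f

module _ {c ℓ m} (K : FiniteField c ℓ m) where
  open FiniteField K
  open RawSemiringOps (Semiring.rawSemiring semiring) using (sum; _^_)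

  monomial : ∀ {q n} → Exponents q n → Vec Carrier n → Carrier
  monomial []       []       = 1#
  monomial (e ∷ es) (x ∷ xs) = x ^ toℕ e * monomial es xs

  sumExponents : ∀ {q} n → (Exponents q n → Carrier) → Carrier
  sumExponents zero    g = g []
  sumExponents (suc n) g = sum λ e → sumExponents n λ es → g (e ∷ es)

  eval : ∀ {q n} → ReducedPoly K q n → Vec Carrier n → Carrier
  eval {n = n} f xs = sumExponents n λ e → f e * monomial e xs

  HasDegree : ∀ {q n} → ReducedPoly K q n → ℕ → Set ℓ
  HasDegree f d = (∃ λ e → ¬ (f e ≈ 0#) × totalDegree e ≡ d)
                × (∀ e → ¬ (f e ≈ 0#) → totalDegree e ≤ d)

  -- The i-th entry of a is overwritten by t, so only the aⱼ with j ≠ i matter.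
  IsLocalPermutation : ∀ {q n} → ReducedPoly K q n → Set (c ⊔ ℓ)
  IsLocalPermutation {n = n} f =
    ∀ (i : Fin n) (a : Vec Carrier n) → Bijective _≈_ _≈_ λ t → eval f (a [ i ]≔ t)

{-# OPTIONS --safe #-}
-- Write δ x = 1 - x ^ (q - 1) for the indicator of 0, γ x = δ x - δ (x - 1), and
-- τ x = x + γ x for the transposition of 0 and 1; all have coefficients in the
-- prime field.  Start from F₀ = 0 and put
--   Fₙ₊₁ (y , x) = - (τ y + σ (Fₙ x))   with σ = id or σ = τ,
-- so that every Fₙ is a local permutation.  For a function h, let Tₙ h be the
-- coefficient of (x₁ ⋯ xₙ) ^ (q - 2) in h ∘ Fₙ, that is, the sum of
-- h (Fₙ x) (- x₁) ⋯ (- xₙ) over all x.  Summing over y first gives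
--   Tₙ₊₁ γ = - Tₙ (κ ∘ σ),   κ u = τ (- u) - τ (- 1 - u),
-- and κ ∘ τ = κ - γ because 2 and 3 are non-zero (p ≥ 5).  Hence, if Tₙ γ ≠ 0, one of
-- the two choices of σ yields Tₙ₊₁ γ ≠ 0.  Since T τ = T id + T γ, one of Fₙ
-- and τ ∘ Fₙ has a monomial of degree n (q - 2).  No monomial of a local permutation
-- contains xᵢ ^ (q - 1), as its values along xᵢ sum to 0, so that degree is maximal.
module Submission where

open import Defs
open import Algebra.Bundles using (CommutativeMonoid)
open import Algebra.Morphism.Structures using (module RingMorphisms)
import Algebra.Properties.CommutativeMonoid.Sum as MonoidSum
import Algebra.Properties.CommutativeSemiring.Exp as CommutativeSemiringExp
import Algebra.Properties.Ring as RingProperties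
import Algebra.Properties.Semiring.Exp as SemiringExp
import Algebra.Properties.Semiring.Mult as SemiringMult
import Algebra.Properties.Semiring.Sum as SemiringSum
open import Data.Fin as Fin using (Fin; zero; suc; toℕ; fromℕ<; inject≤; punchIn)
import Data.Fin.Properties as Fin
open import Data.Fin.Permutation using (Permutation′; permutation; _⟨$⟩ʳ_)
open import Data.Nat as ℕ using (ℕ; zero; suc; pred; _∸_; _≤_; _<_; z≤n; s≤s)
open import Data.Nat.Coprimality using (coprime-Bézout; prime⇒coprime)
open import Data.Nat.Divisibility using (_∣_; _∣0; ∣-refl; ∣1⇒≡1)
open import Data.Nat.GCD using (gcd; gcd-greatest; module Bézout)
open import Data.Nat.Primality using (Prime; prime⇒nonZero)
import Data.Nat.Properties as ℕ
open import Data.Product using (Σ; ∃; _×_; _,_; proj₁; proj₂)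
open import Data.Vec as Vec using (Vec; []; _∷_; _[_]≔_)
open import Data.Vec.Functional using (Vector)
open import Function using (_∘_; id)
open import Function.Bundles using (Inverse)
import Function.Construct.Composition as Composition
open import Function.Definitions using (Bijective; Congruent; Injective)
open import Level using (_⊔_)
open import Relation.Binary.Definitions using (Decidable; tri<; tri≈; tri>)
open import Relation.Binary.PropositionalEquality as ≡ using (_≡_; _≢_)
import Relation.Binary.Reasoning.Setoid as SetoidReasoning
open import Relation.Nullary using (¬_; yes; no; contradiction; ¬?; _×-dec_)
open import Relation.Nullary.Decidable using (map′; decidable-stable)

-- Indices other than a given one, and sums with one exceptional term.

avoiding : ∀ {n} → Fin n → Fin (pred n) → Fin n
avoiding {suc n} = punchIn

avoiding-≢ : ∀ {n} (i : Fin n) j → avoiding i j ≢ i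
avoiding-≢ {suc n} = Fin.punchInᵢ≢i

avoiding-injective : ∀ {n} (i : Fin n) {j k} → avoiding i j ≡ avoiding i k → j ≡ k
avoiding-injective {suc n} i = Fin.punchIn-injective i _ _

module SumSupport {c ℓ} (M : CommutativeMonoid c ℓ) where
  open CommutativeMonoid M
  open MonoidSum M

  -- Stated over any commutative monoid: the additive one isolates a single non-zero term, the
  -- multiplicative one evaluates a product of equal factors. Writing the remaining length as
  -- `pred n` lets `n` be a variable such as `q`.
  sum-support : ∀ {n} (t : Vector Carrier n) i {x} →
                (∀ j → j ≢ i → t j ≈ x) → sum t ≈ t i ∙ sum {pred n} λ _ → x
  sum-support {suc n} t i t≈x =
    trans (sum-remove {i = i} t)
          (∙-congˡ (sum-cong-≋ λ j → t≈x (punchIn i j) (Fin.punchInᵢ≢i i j)))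

-- Finite field arithmetic and sums over all field elements.

module FieldProperties {c ℓ q} (K : FiniteField c ℓ q) where
  open FiniteField K public hiding (zero)
  open RingProperties ring public
  open SemiringSum semiring public
  open SetoidReasoning setoid public
  open CommutativeSemiringExp commutativeSemiring public using (^-distrib-*)
  open SemiringExp semiring public using (_^_; ^-congˡ; ^-congʳ; ^-homo-*)
  open Inverse enumeration public using ()
    renaming ( to to index; from to element; to-cong to index-cong
             ; strictlyInverseˡ to index-element; strictlyInverseʳ to element-index)

  element-cong : ∀ {i x} → i ≡ index x → element i ≈ x
  element-cong {x = x} ≡.refl = element-index x

  index-injective : ∀ {x y} → index x ≡ index y → x ≈ y
  index-injective {x} eq = trans (sym (element-index x)) (element-cong eq)

  element-injective : ∀ {i j} → element i ≈ element j → i ≡ j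
  element-injective {i} {j} eq =
    ≡.trans (≡.sym (index-element i)) (≡.trans (index-cong eq) (index-element j))

  infix 4 _≟_
  _≟_ : Decidable _≈_
  x ≟ y = map′ index-injective index-cong (index x Fin.≟ index y)

  ∑ : (Carrier → Carrier) → Carrier
  ∑ f = sum (f ∘ element)

  -- Moves a bijection of the field to the indices, the setting of `sum-permute`.
  bijection⇒permutation : ∀ {φ} → Bijective _≈_ _≈_ φ → Permutation′ q
  bijection⇒permutation {φ} (injective , surjective) = permutation
    (index ∘ φ ∘ element)
    (index ∘ φ⁻¹ ∘ element)
    (λ i → ≡.trans (index-cong (proj₂ (surjective (element i)) (element-index _))) (index-element i))
    (λ i → ≡.trans (index-cong (injective (trans (proj₂ (surjective _) refl) (element-index _)))) (index-element i))
    where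
    φ⁻¹ : Carrier → Carrier
    φ⁻¹ = proj₁ ∘ surjective

  ∑-reindex : ∀ {φ h} → Bijective _≈_ _≈_ φ → Congruent _≈_ _≈_ h → ∑ (h ∘ φ) ≈ ∑ h
  ∑-reindex {φ} {h} bij h-cong = begin
    ∑ (h ∘ φ)                    ≈⟨ sum-cong-≋ {q} (λ i → h-cong (sym (element-index (φ (element i))))) ⟩
    sum (λ i → h (element (bijection⇒permutation bij ⟨$⟩ʳ i)))  ≈⟨ sum-permute (h ∘ element) (bijection⇒permutation bij) ⟨
    ∑ h                          ∎

  strictlyInverse⇒bijective : ∀ {φ ψ} → Congruent _≈_ _≈_ φ → Congruent _≈_ _≈_ ψ →
    (∀ x → ψ (φ x) ≈ x) → (∀ x → φ (ψ x) ≈ x) → Bijective _≈_ _≈_ φ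
  strictlyInverse⇒bijective {φ} {ψ} φ-cong ψ-cong ψφ φψ =
    (λ {x} {y} eq → trans (sym (ψφ x)) (trans (ψ-cong eq) (ψφ y))) ,
    (λ y → ψ y , λ eq → trans (φ-cong eq) (φψ y))

  x-y+y≈x : ∀ x y → x - y + y ≈ x
  x-y+y≈x x y = begin
    x + - y + y    ≈⟨ +-assoc _ _ _ ⟩
    x + (- y + y)  ≈⟨ +-congˡ (-‿inverseˡ y) ⟩
    x + 0#         ≈⟨ +-identityʳ x ⟩
    x              ∎

  x+y-y≈x : ∀ x y → x + y - y ≈ x
  x+y-y≈x x y = begin
    x + y + - y    ≈⟨ +-assoc _ _ _ ⟩
    x + (y + - y)  ≈⟨ +-congˡ (-‿inverseʳ y) ⟩
    x + 0#         ≈⟨ +-identityʳ x ⟩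
    x              ∎

  x-0≈x : ∀ x → x - 0# ≈ x
  x-0≈x x = trans (+-congˡ -0#≈0#) (+-identityʳ x)

  x-y≈0⇒x≈y : ∀ {x y} → x - y ≈ 0# → x ≈ y
  x-y≈0⇒x≈y {x} {y} eq = trans (sym (x-y+y≈x x y)) (trans (+-congʳ eq) (+-identityˡ y))

  *-swap : ∀ x y z → x * (y * z) ≈ y * (x * z)
  *-swap x y z = trans (sym (*-assoc x y z)) (trans (*-congʳ (*-comm x y)) (*-assoc y x z))

  +-bijective : ∀ a → Bijective _≈_ _≈_ (_+ a)
  +-bijective a = strictlyInverse⇒bijective +-congʳ +-congʳ
    (λ x → x+y-y≈x x a) (λ x → x-y+y≈x x a)

  *-cancel-0 : ∀ {x y} → ¬ (x ≈ 0#) → x * y ≈ 0# → y ≈ 0#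
  *-cancel-0 {x} {y} x≉0 xy≈0 with x⁻¹ , xx⁻¹≈1 ← inverse x x≉0 = begin
    y              ≈⟨ *-identityˡ y ⟨
    1# * y         ≈⟨ *-congʳ (trans (sym xx⁻¹≈1) (*-comm x x⁻¹)) ⟩
    x⁻¹ * x * y    ≈⟨ *-assoc _ _ _ ⟩
    x⁻¹ * (x * y)  ≈⟨ *-congˡ xy≈0 ⟩
    x⁻¹ * 0#       ≈⟨ zeroʳ x⁻¹ ⟩
    0#             ∎

  *-bijective : ∀ {a} → ¬ (a ≈ 0#) → Bijective _≈_ _≈_ (a *_)
  *-bijective {a} a≉0 with a⁻¹ , aa⁻¹≈1 ← inverse a a≉0 =
    strictlyInverse⇒bijective *-congˡ *-congˡ
      (cancel (trans (*-comm a⁻¹ a) aa⁻¹≈1)) (cancel aa⁻¹≈1)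
    where
    cancel : ∀ {u v} → u * v ≈ 1# → ∀ x → u * (v * x) ≈ x
    cancel uv≈1 x = trans (sym (*-assoc _ _ _)) (trans (*-congʳ uv≈1) (*-identityˡ x))

  -- Here (a - 1) s = 0 with a - 1 invertible. This turns invariance of a sum or product under
  -- scaling into its vanishing.
  *-fixed⇒0 : ∀ {a s} → ¬ (a ≈ 1#) → a * s ≈ s → s ≈ 0#
  *-fixed⇒0 {a} {s} a≉1 as≈s = *-cancel-0 (a≉1 ∘ x-y≈0⇒x≈y) (begin
    (a - 1#) * s      ≈⟨ [y-z]x≈yx-zx s a 1# ⟩
    a * s - 1# * s    ≈⟨ +-cong as≈s (-‿cong (*-identityˡ s)) ⟩
    s - s             ≈⟨ -‿inverseʳ s ⟩
    0#                ∎)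

  -- Translation by 1 permutes the field.
  ∑-1 : ∑ (λ _ → 1#) ≈ 0#
  ∑-1 = +-cancelˡ (∑ λ x → x) _ _ (begin
    ∑ (λ x → x) + ∑ (λ _ → 1#)  ≈⟨ ∑-distrib-+ element _ ⟨
    ∑ (_+ 1#)                   ≈⟨ ∑-reindex {h = λ x → x} (+-bijective 1#) (λ eq → eq) ⟩
    ∑ (λ x → x)                 ≈⟨ +-identityʳ _ ⟨
    ∑ (λ x → x) + 0#            ∎)

  -- The multiplicative group and the vanishing of power sums.

  private module ∏ where
    open MonoidSum *-commutativeMonoid public
    open SumSupport *-commutativeMonoid public
  open SumSupport +-commutativeMonoid using (sum-support)

  -- The order of the multiplicative group, and the largest exponent in a reduced polynomial.
  N : ℕ
  N = pred q

  q≡1+N : q ≡ suc N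
  q≡1+N = ≡.sym (ℕ.suc-pred q {{Fin.nonZeroIndex (index 0#)}})

  sum-single : ∀ {n} (t : Vector Carrier n) i → (∀ j → j ≢ i → t j ≈ 0#) → sum t ≈ t i
  sum-single {n} t i t≈0 = trans (sum-support t i t≈0)
    (trans (+-congˡ (sum-replicate-zero (pred n))) (+-identityʳ _))

  -- The factor 1 at x = 0 lets a product over the non-zero elements be indexed by the whole field.
  nonZeroPart : Carrier → Carrier → Carrier
  nonZeroPart a x with x ≟ 0#
  ... | yes _ = 1#
  ... | no  _ = a

  nonZeroPart-0 : ∀ {a x} → x ≈ 0# → nonZeroPart a x ≈ 1#
  nonZeroPart-0 {x = x} x≈0 with x ≟ 0#
  ... | yes _   = refl
  ... | no  x≉0 = contradiction x≈0 x≉0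

  nonZeroPart-≉0 : ∀ {a x} → ¬ (x ≈ 0#) → nonZeroPart a x ≈ a
  nonZeroPart-≉0 {x = x} x≉0 with x ≟ 0#
  ... | yes x≈0 = contradiction x≈0 x≉0
  ... | no  _   = refl

  ∏-≉0 : ∀ {n} (t : Vector Carrier n) → (∀ i → ¬ (t i ≈ 0#)) → ¬ (∏.sum t ≈ 0#)
  ∏-≉0 {zero}  t t≉0 eq = 0≉1 (sym eq)
  ∏-≉0 {suc n} t t≉0 eq = ∏-≉0 (t ∘ suc) (t≉0 ∘ suc) (*-cancel-0 (t≉0 zero) eq)

  -- Multiplication by a permutes the field, hence fixes the product of all
  -- non-zero elements, which it also multiplies by a ^ N.
  x^N≈1 : ∀ {a} → ¬ (a ≈ 0#) → a ^ N ≈ 1#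
  x^N≈1 {a} a≉0 = decidable-stable (_ ≟ _) λ a^N≉1 →
    ∏-≉0 (unit ∘ element) (λ i → unit≉0 (element i)) (*-fixed⇒0 a^N≉1 (begin
      a ^ N * ∏.sum (unit ∘ element)                            ≈⟨ *-congʳ product-of-as ⟨
      ∏.sum (nonZeroPart a ∘ element) * ∏.sum (unit ∘ element)  ≈⟨ ∏.∑-distrib-+ (nonZeroPart a ∘ element) (unit ∘ element) ⟨
      ∏.sum (λ i → nonZeroPart a (element i) * unit (element i)) ≈⟨ ∏.sum-cong-≋ (λ i → unit-* (element i)) ⟨
      ∏.sum (λ i → unit (a * element i))                        ≈⟨ ∏.sum-cong-≋ {q} (λ i → unit-cong (sym (element-index (a * element i)))) ⟩
      ∏.sum (λ i → unit (element (π ⟨$⟩ʳ i)))                   ≈⟨ ∏.sum-permute (unit ∘ element) π ⟨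
      ∏.sum (unit ∘ element)                                    ∎))
    where
    π : Permutation′ q
    π = bijection⇒permutation (*-bijective a≉0)

    unit : Carrier → Carrier
    unit x = nonZeroPart x x

    unit-cong : Congruent _≈_ _≈_ unit
    unit-cong {x} {y} x≈y with x ≟ 0#
    ... | yes x≈0 = sym (nonZeroPart-0 (trans (sym x≈y) x≈0))
    ... | no  x≉0 = trans x≈y (sym (nonZeroPart-≉0 (x≉0 ∘ trans x≈y)))

    unit≉0 : ∀ x → ¬ (unit x ≈ 0#)
    unit≉0 x with x ≟ 0#
    ... | yes _   = 0≉1 ∘ sym
    ... | no  x≉0 = x≉0

    unit-* : ∀ x → unit (a * x) ≈ nonZeroPart a x * unit x
    unit-* x with x ≟ 0#
    ... | yes x≈0 = trans (nonZeroPart-0 (trans (*-congˡ x≈0) (zeroʳ a))) (sym (*-identityˡ 1#))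
    ... | no  x≉0 = nonZeroPart-≉0 (x≉0 ∘ *-cancel-0 a≉0)

    product-of-as : ∏.sum (nonZeroPart a ∘ element) ≈ a ^ N
    product-of-as = begin
      ∏.sum (nonZeroPart a ∘ element)
        ≈⟨ ∏.sum-support (nonZeroPart a ∘ element) (index 0#)
             (λ j j≢0 → nonZeroPart-≉0 (λ eq → j≢0 (≡.trans (≡.sym (index-element j)) (index-cong eq)))) ⟩
      nonZeroPart a (element (index 0#)) * ∏.sum {N} (λ _ → a)
        ≈⟨ *-cong (nonZeroPart-0 (element-index 0#)) (∏.sum-replicate N) ⟩
      1# * a ^ N
        ≈⟨ *-identityˡ _ ⟩
      a ^ N ∎

  x^[1+N]≈x : ∀ x → x ^ suc N ≈ x
  x^[1+N]≈x x with x ≟ 0#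
  ... | yes x≈0 = trans (*-congʳ x≈0) (trans (zeroˡ _) (sym x≈0))
  ... | no  x≉0 = trans (*-congˡ (x^N≈1 x≉0)) (*-identityʳ x)

  δ : Carrier → Carrier
  δ x = 1# - x ^ N

  δ-cong : Congruent _≈_ _≈_ δ
  δ-cong eq = +-congˡ (-‿cong (^-congˡ N eq))

  δ-≉0 : ∀ {x} → ¬ (x ≈ 0#) → δ x ≈ 0#
  δ-≉0 x≉0 = trans (+-congˡ (-‿cong (x^N≈1 x≉0))) (-‿inverseʳ 1#)

  -- Polynomial functions of degree at most m, by iterated difference quotients.
  Degree≤ : ℕ → (Carrier → Carrier) → Set _
  Degree≤ zero    f = ∀ x y → f x ≈ f y
  Degree≤ (suc m) f = ∀ a → ∃ λ g → Degree≤ m g × (∀ x → f x ≈ f a + (x - a) * g x)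

  degree≤-+ : ∀ m {f} b → Degree≤ m f → Degree≤ m (λ x → b + f x)
  degree≤-+ zero    b d x y = +-congˡ (d x y)
  degree≤-+ (suc m) b d a with g , dg , eq ← d a =
    g , dg , λ x → trans (+-congˡ (eq x)) (sym (+-assoc _ _ _))

  x*y≈a*y+[x-a]*y : ∀ x a y → x * y ≈ a * y + (x - a) * y
  x*y≈a*y+[x-a]*y x a y = begin
    x * y                  ≈⟨ *-congʳ (trans (+-comm a (x - a)) (x-y+y≈x x a)) ⟨
    (a + (x - a)) * y      ≈⟨ distribʳ y a (x - a) ⟩
    a * y + (x - a) * y    ∎

  -- If g is the difference quotient of f at a, then that of x f(x) is f(a) + x g(x), to which
  -- induction applies.
  degree≤-* : ∀ m {f} → Degree≤ m f → Degree≤ (suc m) (λ x → x * f x)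
  degree≤-* zero    {f} d a = f , d , λ x → begin
    x * f x                  ≈⟨ x*y≈a*y+[x-a]*y x a (f x) ⟩
    a * f x + (x - a) * f x  ≈⟨ +-congʳ (*-congˡ (d x a)) ⟩
    a * f a + (x - a) * f x  ∎
  degree≤-* (suc m) {f} d a with g , dg , eq ← d a =
    (λ x → f a + x * g x) , degree≤-+ (suc m) (f a) (degree≤-* m dg) , λ x → begin
    x * f x                                          ≈⟨ *-congˡ (eq x) ⟩
    x * (f a + (x - a) * g x)                        ≈⟨ distribˡ x _ _ ⟩
    x * f a + x * ((x - a) * g x)                    ≈⟨ +-cong (x*y≈a*y+[x-a]*y x a (f a)) (*-swap x (x - a) (g x)) ⟩
    a * f a + (x - a) * f a + (x - a) * (x * g x)    ≈⟨ +-assoc _ _ _ ⟩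
    a * f a + ((x - a) * f a + (x - a) * (x * g x))  ≈⟨ +-congˡ (distribˡ (x - a) _ _) ⟨
    a * f a + (x - a) * (f a + x * g x)              ∎

  degree≤-^ : ∀ k → Degree≤ k (_^ k)
  degree≤-^ zero    x y = refl
  degree≤-^ (suc k) = degree≤-* k (degree≤-^ k)

  -- Root counting: the difference quotient at the first point vanishes at the m remaining points,
  -- since `pt` is injective, and so is 0 by induction.
  degree≤⇒constant : ∀ m {f b} → Degree≤ m f → (pt : Fin (suc m) → Carrier) →
    Injective _≡_ _≈_ pt → (∀ i → f (pt i) ≈ b) → ∀ x → f x ≈ b
  degree≤⇒constant zero    d pt inj f≈b x = trans (d x (pt zero)) (f≈b zero)
  degree≤⇒constant (suc m) {f} {b} d pt inj f≈b x with g , dg , eq ← d (pt zero) = begin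
    f x                                    ≈⟨ eq x ⟩
    f (pt zero) + (x - pt zero) * g x      ≈⟨ +-cong (f≈b zero) (*-congˡ (g≈0 x)) ⟩
    b + (x - pt zero) * 0#                 ≈⟨ +-congˡ (zeroʳ _) ⟩
    b + 0#                                 ≈⟨ +-identityʳ b ⟩
    b                                      ∎
    where
    g-root : ∀ i → g (pt (suc i)) ≈ 0#
    g-root i = *-cancel-0 (λ eq₀ → Fin.0≢1+n (≡.sym (inj (x-y≈0⇒x≈y eq₀))))
      (+-cancelˡ b _ _ (begin
        b + (pt (suc i) - pt zero) * g (pt (suc i))            ≈⟨ +-congʳ (f≈b zero) ⟨
        f (pt zero) + (pt (suc i) - pt zero) * g (pt (suc i))  ≈⟨ eq (pt (suc i)) ⟨
        f (pt (suc i))                                         ≈⟨ f≈b (suc i) ⟩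
        b                                                      ≈⟨ +-identityʳ b ⟨
        b + 0#                                                 ∎))

    g≈0 : ∀ x → g x ≈ 0#
    g≈0 = degree≤⇒constant m dg (pt ∘ suc) (Fin.suc-injective ∘ inj) g-root

  -- Otherwise x ^ k would equal 1 at k + 1 ≤ N distinct non-zero points and hence everywhere,
  -- although it is 0 at 0. A search through the finite field provides the witness.
  ∃-power≉1 : ∀ {k} → 0 < k → k < N → ∃ λ a → ¬ (a ≈ 0#) × ¬ (a ^ k ≈ 1#)
  ∃-power≉1 {suc k} _ k<N
    with Fin.any? (λ i → ¬? (element i ≟ 0#) ×-dec ¬? (element i ^ suc k ≟ 1#))
  ... | yes (i , p) = element i , p
  ... | no  ∄       = contradiction
    (trans (sym (zeroˡ _)) (degree≤⇒constant (suc k) (degree≤-^ (suc k)) nonZero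
      (λ eq → Fin.inject≤-injective _ _ _ _ (avoiding-injective (index 0#) (element-injective eq)))
      (λ i → decidable-stable (_ ≟ _) λ ≉1 → ∄ (_ , (nonZero≉0 i , ≉1)))
      0#)) 0≉1
    where
    nonZero : Fin (suc (suc k)) → Carrier
    nonZero i = element (avoiding (index 0#) (inject≤ i k<N))

    nonZero≉0 : ∀ i → ¬ (nonZero i ≈ 0#)
    nonZero≉0 i eq = avoiding-≢ (index 0#) (inject≤ i k<N)
      (≡.trans (≡.sym (index-element _)) (index-cong eq))

  -- Replacing x by a x permutes the field and multiplies the sum by a ^ k; choose a with a ^ k ≠ 1.
  -- For k = 0 every term is 1, also the one at x = 0.
  ∑-^ : ∀ {k} → k < N → ∑ (_^ k) ≈ 0#
  ∑-^ {zero}  _   = ∑-1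
  ∑-^ {suc k} k<N with a , a≉0 , a^k≉1 ← ∃-power≉1 (s≤s z≤n) k<N = *-fixed⇒0 a^k≉1 (begin
    a ^ suc k * ∑ (_^ suc k)          ≈⟨ *-distribˡ-sum (a ^ suc k) (λ i → element i ^ suc k) ⟩
    ∑ (λ x → a ^ suc k * x ^ suc k)   ≈⟨ sum-cong-≋ (λ i → ^-distrib-* a (element i) (suc k)) ⟨
    ∑ (λ x → (a * x) ^ suc k)         ≈⟨ ∑-reindex {h = _^ suc k} (*-bijective a≉0) (^-congˡ (suc k)) ⟩
    ∑ (_^ suc k)                      ∎)

-- Evaluation of reduced polynomials, one variable at a time.

module Evaluation {c ℓ m} (K : FiniteField c ℓ m) where
  open FieldProperties K

  sumExponents-cong : ∀ {q} n {f g : Exponents q n → Carrier} →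
    (∀ e → f e ≈ g e) → sumExponents K n f ≈ sumExponents K n g
  sumExponents-cong zero    f≈g = f≈g []
  sumExponents-cong {q} (suc n) f≈g =
    sum-cong-≋ {q} λ e → sumExponents-cong n λ es → f≈g (e ∷ es)

  sumExponents-* : ∀ {q} n a (f : Exponents q n → Carrier) →
    a * sumExponents K n f ≈ sumExponents K n (λ e → a * f e)
  sumExponents-* zero    a f = refl
  sumExponents-* {q} (suc n) a f = trans
    (*-distribˡ-sum {q} a (λ e → sumExponents K n λ es → f (e ∷ es)))
    (sum-cong-≋ {q} λ e → sumExponents-* n a λ es → f (e ∷ es))

  eval-∷ : ∀ {q n} (f : ReducedPoly K q (suc n)) x xs →
    eval K f (x ∷ xs) ≈ sum λ e → x ^ toℕ e * eval K (λ es → f (e ∷ es)) xs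
  eval-∷ {q} {n} f x xs = sum-cong-≋ {q} λ e → trans
    (sumExponents-cong n λ es → *-swap (f (e ∷ es)) (x ^ toℕ e) (monomial K es xs))
    (sym (sumExponents-* n (x ^ toℕ e) _))

-- Recovering the coefficients of a polynomial from its values.

module Coefficients {c ℓ q} (K : FiniteField c ℓ q) (2<q : 2 < q) where
  open FieldProperties K public
  open Evaluation K public

  1<N : 1 < N
  1<N = ℕ.≤-pred (ℕ.≤-trans 2<q (ℕ.≤-reflexive q≡1+N))

  toℕ≤N : (e : Fin q) → toℕ e ≤ N
  toℕ≤N = Fin.toℕ≤pred[n]

  0^k≈0 : ∀ {x k} → 0 < k → x ≈ 0# → x ^ k ≈ 0#
  0^k≈0 {k = suc k} _ x≈0 = trans (*-congʳ x≈0) (zeroˡ _)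

  δ-0 : ∀ {x} → x ≈ 0# → δ x ≈ 1#
  δ-0 x≈0 = trans (+-congˡ (-‿cong (0^k≈0 (ℕ.<⇒≤ 1<N) x≈0))) (x-0≈x 1#)

  ∑-δ : ∀ f a → Congruent _≈_ _≈_ f → ∑ (λ x → f x * δ (x - a)) ≈ f a
  ∑-δ f a f-cong = begin
    ∑ (λ x → f x * δ (x - a))
      ≈⟨ sum-single _ (index a) (λ j j≢a → trans (*-congˡ (δ-≉0 (j≢a ∘ x-a≈0⇒ j))) (zeroʳ (f (element j)))) ⟩
    f a′ * δ (a′ - a)
      ≈⟨ *-cong (f-cong (element-index a)) (δ-0 (x≈y⇒x∙y⁻¹≈ε (element-index a))) ⟩
    f a * 1#
      ≈⟨ *-identityʳ _ ⟩
    f a ∎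
    where
    a′ : Carrier
    a′ = element (index a)

    x-a≈0⇒ : ∀ j → element j - a ≈ 0# → j ≡ index a
    x-a≈0⇒ j eq = ≡.trans (≡.sym (index-element j)) (index-cong (x-y≈0⇒x≈y eq))

  ∑-δ₀ : ∀ f → Congruent _≈_ _≈_ f → ∑ (λ x → f x * δ x) ≈ f 0#
  ∑-δ₀ f f-cong = trans
    (sum-cong-≋ {q} λ i → *-congˡ (δ-cong (sym (x-0≈x (element i)))))
    (∑-δ f 0# f-cong)

  ∑-neg : ∀ f → ∑ (λ x → - f x) ≈ - ∑ f
  ∑-neg f = begin
    ∑ (λ x → - f x)        ≈⟨ sum-cong-≋ {q} (λ i → -1*x≈-x (f (element i))) ⟨
    ∑ (λ x → - 1# * f x)   ≈⟨ *-distribˡ-sum {q} (- 1#) (f ∘ element) ⟨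
    - 1# * ∑ f             ≈⟨ -1*x≈-x _ ⟩
    - ∑ f                  ∎

  -- As the sum of 1 over the field is 0, the left side is the sum of δ, to which only x = 0
  -- contributes.
  -∑-^N : - ∑ (_^ N) ≈ 1#
  -∑-^N = begin
    - ∑ (_^ N)                        ≈⟨ +-identityˡ _ ⟨
    0# - ∑ (_^ N)                     ≈⟨ +-congʳ ∑-1 ⟨
    ∑ (λ _ → 1#) - ∑ (_^ N)           ≈⟨ +-congˡ (∑-neg (_^ N)) ⟨
    ∑ (λ _ → 1#) + ∑ (λ x → - x ^ N)  ≈⟨ ∑-distrib-+ {q} (λ _ → 1#) _ ⟨
    ∑ δ                               ≈⟨ sum-cong-≋ {q} (λ i → *-identityˡ (δ (element i))) ⟨
    ∑ (λ x → 1# * δ x)                ≈⟨ ∑-δ₀ (λ _ → 1#) (λ _ → refl) ⟩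
    1#                                ∎

  -- The basis of functions dual to the powers x ^ j (j ≤ N) under summation
  -- of products.
  dual : ℕ → Carrier → Carrier
  dual zero      = δ
  dual (suc e) x = - x ^ (N ∸ suc e)

  ∑-dual-suc : ∀ e j → ∑ (λ x → dual (suc e) x * x ^ j) ≈ - ∑ (_^ (N ∸ suc e ℕ.+ j))
  ∑-dual-suc e j = begin
    ∑ (λ x → - x ^ k * x ^ j)       ≈⟨ sum-cong-≋ {q} (λ i → -‿distribˡ-* (element i ^ k) (element i ^ j)) ⟨
    ∑ (λ x → - (x ^ k * x ^ j))     ≈⟨ ∑-neg (λ x → x ^ k * x ^ j) ⟩
    - ∑ (λ x → x ^ k * x ^ j)       ≈⟨ -‿cong (sum-cong-≋ {q} λ i → ^-homo-* (element i) k j) ⟨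
    - ∑ (_^ (k ℕ.+ j))              ∎
    where
    k : ℕ
    k = N ∸ suc e

  -- The exponent after reduction must be positive: x ^ N is not 1 at x = 0, whereas x ^ (N + 1) = x
  -- holds everywhere.
  ∑-^-reduce : ∀ k → ∑ (_^ (N ℕ.+ suc k)) ≈ ∑ (_^ suc k)
  ∑-^-reduce k = sum-cong-≋ {q} λ i → let x = element i in begin
    x ^ (N ℕ.+ suc k)      ≡⟨ ≡.cong (x ^_) (ℕ.+-suc N k) ⟩
    x ^ (suc N ℕ.+ k)      ≈⟨ ^-homo-* x (suc N) k ⟩
    x ^ suc N * x ^ k      ≈⟨ *-congʳ (x^[1+N]≈x x) ⟩
    x * x ^ k              ∎

  ∑-dual-≡ : ∀ {e} → e ≤ N → ∑ (λ x → dual e x * x ^ e) ≈ 1#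
  ∑-dual-≡ {zero}  _   = trans (sum-cong-≋ {q} λ i → *-comm (δ (element i)) 1#) (∑-δ₀ (λ _ → 1#) (λ _ → refl))
  ∑-dual-≡ {suc e} e≤N = begin
    ∑ (λ x → dual (suc e) x * x ^ suc e)     ≈⟨ ∑-dual-suc e (suc e) ⟩
    - ∑ (_^ (N ∸ suc e ℕ.+ suc e))           ≡⟨ ≡.cong (λ k → - ∑ (_^ k)) (ℕ.m∸n+n≡m e≤N) ⟩
    - ∑ (_^ N)                               ≈⟨ -∑-^N ⟩
    1#                                       ∎

  -- For e = 0, δ evaluates x ^ j at 0. For e > 0 the power sum has exponent N - e + j: below N if j
  -- < e, and reducible to j - e if j > e. The bound j - e < N uses e > 0, which is why `dual zero`
  -- has a form of its own.
  ∑-dual-≢ : ∀ {e j} → e ≤ N → j ≤ N → j ≢ e → ∑ (λ x → dual e x * x ^ j) ≈ 0#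
  ∑-dual-≢ {zero}  {zero}  _ _ j≢e = contradiction ≡.refl j≢e
  ∑-dual-≢ {zero}  {suc j} _ _ j≢e = trans
    (sum-cong-≋ {q} λ i → *-comm (δ (element i)) (element i ^ suc j))
    (trans (∑-δ₀ (_^ suc j) (^-congˡ (suc j))) (0^k≈0 {k = suc j} (s≤s z≤n) refl))
  ∑-dual-≢ {suc e} {j} e≤N j≤N j≢e = trans (∑-dual-suc e j)
    (trans (-‿cong powerSum) -0#≈0#)
    where
    N∸e+e≡N : N ∸ suc e ℕ.+ suc e ≡ N
    N∸e+e≡N = ℕ.m∸n+n≡m e≤N

    powerSum : ∑ (_^ (N ∸ suc e ℕ.+ j)) ≈ 0#
    powerSum with ℕ.<-cmp j (suc e)
    ... | tri< j<e _ _ = ∑-^ (ℕ.<-≤-trans (ℕ.+-monoʳ-< (N ∸ suc e) j<e) (ℕ.≤-reflexive N∸e+e≡N))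
    ... | tri≈ _ j≡e _ = contradiction j≡e j≢e
    ... | tri> _ _ e<j = begin
      ∑ (_^ (N ∸ suc e ℕ.+ j))  ≡⟨ ≡.cong (λ k → ∑ (_^ k)) exponent ⟩
      ∑ (_^ (N ℕ.+ suc k))      ≈⟨ ∑-^-reduce k ⟩
      ∑ (_^ suc k)              ≈⟨ ∑-^ 1+k<N ⟩
      0#                        ∎
      where
      -- Chosen so that `suc k` is the difference between `j` and `suc e`, positive by `e<j`.
      k : ℕ
      k = j ∸ suc (suc e)

      j≡ : suc e ℕ.+ suc k ≡ j
      j≡ = ≡.trans (ℕ.+-suc (suc e) k) (ℕ.m+[n∸m]≡n e<j)

      exponent : N ∸ suc e ℕ.+ j ≡ N ℕ.+ suc k
      exponent = ≡.trans (≡.cong (N ∸ suc e ℕ.+_) (≡.sym j≡))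
        (≡.trans (≡.sym (ℕ.+-assoc (N ∸ suc e) (suc e) (suc k))) (≡.cong (ℕ._+ suc k) N∸e+e≡N))

      1+k<N : suc k < N
      1+k<N = ℕ.<-≤-trans (ℕ.m<n+m (suc k) (s≤s z≤n)) (ℕ.≤-trans (ℕ.≤-reflexive j≡) j≤N)

  -- Defined on functions rather than polynomials, so that it applies to a composite such as `γ ∘ f`
  -- directly. `coefficient-eval` shows that it gives the actual coefficient.
  coefficient : ∀ {n} → Exponents q n → (Vec Carrier n → Carrier) → Carrier
  coefficient []       h = h []
  coefficient (e ∷ es) h = ∑ λ x → dual (toℕ e) x * coefficient es λ xs → h (x ∷ xs)

  coefficient-cong : ∀ {n} (es : Exponents q n) {g h} →
    (∀ xs → g xs ≈ h xs) → coefficient es g ≈ coefficient es h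
  coefficient-cong []       g≈h = g≈h []
  coefficient-cong (e ∷ es) g≈h = sum-cong-≋ {q} λ i →
    *-congˡ (coefficient-cong es λ xs → g≈h (element i ∷ xs))

  -- Linearity, by exchanging finite sums. The general number `m` of terms covers expansions in
  -- powers of a variable (m = q), scalar multiples (m = 1) and binary sums (m = 2).
  coefficient-∑ : ∀ {n} (es : Exponents q n) {m} (a : Vector Carrier m) (h : Fin m → Vec Carrier n → Carrier) →
    coefficient es (λ xs → sum λ i → a i * h i xs) ≈ sum λ i → a i * coefficient es (h i)
  coefficient-∑ []       a h = refl
  coefficient-∑ (e ∷ es) {m} a h = begin
    ∑ (λ x → dual (toℕ e) x * coefficient es λ xs → sum λ i → a i * h i (x ∷ xs))
      ≈⟨ sum-cong-≋ {q} (λ j → *-congˡ (coefficient-∑ es a λ i xs → h i (element j ∷ xs))) ⟩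
    ∑ (λ x → dual (toℕ e) x * sum λ i → a i * hᵢ x i)
      ≈⟨ sum-cong-≋ {q} (λ j → *-distribˡ-sum {m} (dual (toℕ e) (element j)) _) ⟩
    ∑ (λ x → sum λ i → dual (toℕ e) x * (a i * hᵢ x i))
      ≈⟨ ∑-comm {q} {m} (λ j i → dual (toℕ e) (element j) * (a i * hᵢ (element j) i)) ⟩
    sum (λ i → ∑ λ x → dual (toℕ e) x * (a i * hᵢ x i))
      ≈⟨ sum-cong-≋ {m} (λ i → sum-cong-≋ {q} λ j → *-swap (dual (toℕ e) (element j)) (a i) _) ⟩
    sum (λ i → ∑ λ x → a i * (dual (toℕ e) x * hᵢ x i))
      ≈⟨ sum-cong-≋ {m} (λ i → *-distribˡ-sum {q} (a i) _) ⟨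
    sum (λ i → a i * ∑ λ x → dual (toℕ e) x * hᵢ x i) ∎
    where
    hᵢ : Carrier → Fin m → Carrier
    hᵢ x i = coefficient es λ xs → h i (x ∷ xs)

  coefficient-* : ∀ {n} (es : Exponents q n) a h →
    coefficient es (λ xs → a * h xs) ≈ a * coefficient es h
  coefficient-* es a h = begin
    coefficient es (λ xs → a * h xs)        ≈⟨ coefficient-cong es (λ xs → +-identityʳ _) ⟨
    coefficient es (λ xs → a * h xs + 0#)   ≈⟨ coefficient-∑ es {1} (λ _ → a) (λ _ → h) ⟩
    a * coefficient es h + 0#               ≈⟨ +-identityʳ _ ⟩
    a * coefficient es h                    ∎

  coefficient-+ : ∀ {n} (es : Exponents q n) g h →
    coefficient es (λ xs → g xs + h xs) ≈ coefficient es g + coefficient es h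
  coefficient-+ es g h = begin
    coefficient es (λ xs → g xs + h xs)
      ≈⟨ coefficient-cong es (λ xs → one*+one*+0 (g xs) (h xs)) ⟨
    coefficient es (λ xs → 1# * g xs + (1# * h xs + 0#))
      ≈⟨ coefficient-∑ es {2} (λ _ → 1#) (λ { zero → g ; (suc _) → h }) ⟩
    1# * coefficient es g + (1# * coefficient es h + 0#)
      ≈⟨ one*+one*+0 _ _ ⟩
    coefficient es g + coefficient es h ∎
    where
    one*+one*+0 : ∀ x y → 1# * x + (1# * y + 0#) ≈ x + y
    one*+one*+0 x y = +-cong (*-identityˡ x) (trans (+-identityʳ _) (*-identityˡ y))

  coefficient-neg : ∀ {n} (es : Exponents q n) h →
    coefficient es (λ xs → - h xs) ≈ - coefficient es h
  coefficient-neg es h = trans (coefficient-cong es λ xs → sym (-1*x≈-x (h xs)))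
    (trans (coefficient-* es (- 1#) h) (-1*x≈-x _))

  -- Expand in powers of the first variable and exchange the two sums: duality leaves only the power
  -- with exponent `e`, and induction handles the other variables.
  coefficient-eval : ∀ {n} (f : ReducedPoly K q n) es → coefficient es (eval K f) ≈ f es
  coefficient-eval f []       = *-identityʳ (f [])
  coefficient-eval f (e ∷ es) = begin
    ∑ (λ x → dual (toℕ e) x * coefficient es λ xs → eval K f (x ∷ xs))
      ≈⟨ sum-cong-≋ {q} (λ i → *-congˡ (inner (element i))) ⟩
    ∑ (λ x → dual (toℕ e) x * sum λ j → x ^ toℕ j * f (j ∷ es))
      ≈⟨ sum-cong-≋ {q} (λ i → *-distribˡ-sum {q} (dual (toℕ e) (element i)) _) ⟩
    ∑ (λ x → sum λ j → dual (toℕ e) x * (x ^ toℕ j * f (j ∷ es)))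
      ≈⟨ ∑-comm {q} {q} (λ i j → dual (toℕ e) (element i) * (element i ^ toℕ j * f (j ∷ es))) ⟩
    sum (λ j → ∑ λ x → dual (toℕ e) x * (x ^ toℕ j * f (j ∷ es)))
      ≈⟨ sum-cong-≋ {q} (λ j → sum-cong-≋ {q} λ i → *-assoc (dual (toℕ e) (element i)) _ (f (j ∷ es))) ⟨
    sum (λ j → ∑ λ x → dual (toℕ e) x * x ^ toℕ j * f (j ∷ es))
      ≈⟨ sum-cong-≋ {q} (λ j → *-distribʳ-sum {q} (f (j ∷ es)) _) ⟨
    sum (λ j → ∑ (λ x → dual (toℕ e) x * x ^ toℕ j) * f (j ∷ es))
      ≈⟨ sum-single _ e (λ j j≢e → trans (*-congʳ (∑-dual-≢ (toℕ≤N e) (toℕ≤N j) (j≢e ∘ Fin.toℕ-injective))) (zeroˡ (f (j ∷ es)))) ⟩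
    ∑ (λ x → dual (toℕ e) x * x ^ toℕ e) * f (e ∷ es)
      ≈⟨ *-congʳ (∑-dual-≡ (toℕ≤N e)) ⟩
    1# * f (e ∷ es)
      ≈⟨ *-identityˡ _ ⟩
    f (e ∷ es) ∎
    where
    inner : ∀ x → coefficient es (λ xs → eval K f (x ∷ xs)) ≈ sum λ j → x ^ toℕ j * f (j ∷ es)
    inner x = begin
      coefficient es (λ xs → eval K f (x ∷ xs))
        ≈⟨ coefficient-cong es (λ xs → eval-∷ f x xs) ⟩
      coefficient es (λ xs → sum λ j → x ^ toℕ j * eval K (λ es → f (j ∷ es)) xs)
        ≈⟨ coefficient-∑ es (λ j → x ^ toℕ j) (λ j → eval K λ es → f (j ∷ es)) ⟩
      sum (λ j → x ^ toℕ j * coefficient es (eval K λ es → f (j ∷ es)))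
        ≈⟨ sum-cong-≋ {q} (λ j → *-congˡ (coefficient-eval (λ es → f (j ∷ es)) es)) ⟩
      sum (λ j → x ^ toℕ j * f (j ∷ es)) ∎

  coefficient-0 : ∀ {n} (es : Exponents q n) {h} → (∀ xs → h xs ≈ 0#) → coefficient es h ≈ 0#
  coefficient-0 es {h} h≈0 = trans (coefficient-cong es λ xs → trans (h≈0 xs) (sym (zeroˡ _)))
    (trans (coefficient-* es 0# h) (zeroˡ _))

  -- Moves the sum over the first variable innermost, where it can be evaluated with the other
  -- variables fixed.
  coefficient-∷ : ∀ {n} e (es : Exponents q n) h →
    coefficient (e ∷ es) h ≈ coefficient es λ xs → ∑ λ x → dual (toℕ e) x * h (x ∷ xs)
  coefficient-∷ e es h = sym (coefficient-∑ es (λ i → dual (toℕ e) (element i)) (λ i xs → h (element i ∷ xs)))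

  dual-positive : ∀ {e} x → 0 < e → dual e x ≈ - x ^ (N ∸ e)
  dual-positive {suc e} x _ = refl

  dual-N : ∀ x → dual N x ≈ - 1#
  dual-N x = trans (dual-positive x (ℕ.<⇒≤ 1<N)) (-‿cong (^-congʳ x (ℕ.n∸n≡0 N)))

  -- The exponent is N - (q - 2) = 1, and 2 < q keeps q - 2 positive, away from the case of δ. This
  -- is the source of the weights - xᵢ in Tₙ.
  dual-[q-2] : ∀ x → dual (q ∸ 2) x ≈ - x
  dual-[q-2] x = trans (dual-positive x (ℕ.m<n⇒0<n∸m 2<q))
    (-‿cong (trans (^-congʳ x (pred[m]∸[m∸2]≡1 2<q)) (*-identityʳ x)))
    where
    pred[m]∸[m∸2]≡1 : ∀ {m} → 2 < m → pred m ∸ (m ∸ 2) ≡ 1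
    pred[m]∸[m∸2]≡1 {suc zero}    (s≤s ())
    pred[m]∸[m∸2]≡1 {suc (suc m)} _ = ℕ.m+n∸n≡m 1 m

  -- The coefficient of x ^ N in a univariate function is minus the sum of its values.
  coefficient-vanishes : ∀ {n} (es : Exponents q n) (h : Vec Carrier n → Carrier) i →
    toℕ (Vec.lookup es i) ≡ N → (∀ xs → ∑ (λ t → h (xs [ i ]≔ t)) ≈ 0#) → coefficient es h ≈ 0#
  coefficient-vanishes (e ∷ es) h zero e≡N ∑h≈0 = trans (coefficient-∷ e es h)
    (coefficient-0 es λ xs → begin
      ∑ (λ x → dual (toℕ e) x * h (x ∷ xs))  ≈⟨ sum-cong-≋ {q} (λ i → *-congʳ (trans (reflexive (≡.cong (λ k → dual k (element i)) e≡N)) (dual-N (element i)))) ⟩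
      ∑ (λ x → - 1# * h (x ∷ xs))      ≈⟨ *-distribˡ-sum {q} (- 1#) _ ⟨
      - 1# * ∑ (λ x → h (x ∷ xs))      ≈⟨ *-congˡ (∑h≈0 (0# ∷ xs)) ⟩
      - 1# * 0#                        ≈⟨ zeroʳ _ ⟩
      0#                               ∎)
  coefficient-vanishes (e ∷ es) h (suc i) eᵢ≡N ∑h≈0 = trans
    (sum-cong-≋ {q} λ j → trans
      (*-congˡ (coefficient-vanishes es (λ xs → h (element j ∷ xs)) i eᵢ≡N λ xs → ∑h≈0 (element j ∷ xs)))
      (zeroʳ _))
    (sum-replicate-zero q)

-- Functions given by reduced polynomials over the subfield.

module PolynomialFunctions {c₁ ℓ₁ c₂ ℓ₂ p q} (E : FiniteField c₁ ℓ₁ p)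
  (K : FiniteField c₂ ℓ₂ q) (2<q : 2 < q) (ι : Embedding E K) where
  private module E = FiniteField E
  open Coefficients K 2<q
  open Embedding ι
  open RingMorphisms E.rawRing rawRing using (IsRingHomomorphism)
  open IsRingHomomorphism isRingHomomorphism using (+-homo; *-homo; -‿homo; 0#-homo; 1#-homo)

  -- The coefficients lie in `E`, while the exponent bound and the evaluation refer to `K`. Closure
  -- under the ring operations thus keeps the construction over the prime field.
  IsPolynomial : ∀ n → (Vec Carrier n → Carrier) → Set (c₁ ⊔ c₂ ⊔ ℓ₂)
  IsPolynomial n f = Σ (ReducedPoly E q n) λ F →
    ∀ xs → eval K (extendScalars {E = E} {K = K} ι F) xs ≈ f xs

  poly-cong : ∀ {n f g} → (∀ xs → f xs ≈ g xs) → IsPolynomial n f → IsPolynomial n g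
  poly-cong f≈g (F , eq) = F , λ xs → trans (eq xs) (f≈g xs)

  -- Together with `expand`, passes between a polynomial in `suc n` variables and its `q`
  -- coefficients in powers of the first variable; sums and products are treated by induction this
  -- way.
  collect : ∀ {n f} (g : Fin q → Vec Carrier n → Carrier) → (∀ e → IsPolynomial n (g e)) →
    (∀ x xs → sum (λ e → x ^ toℕ e * g e xs) ≈ f (x ∷ xs)) → IsPolynomial (suc n) f
  collect {n} {f} g G eq = F , correct
    where
    F : ReducedPoly E q (suc n)
    F (e ∷ es) = proj₁ (G e) es

    correct : ∀ xs → eval K (extendScalars {E = E} {K = K} ι F) xs ≈ f xs
    correct (x ∷ xs) = trans (eval-∷ (extendScalars {E = E} {K = K} ι F) x xs)
      (trans (sum-cong-≋ {q} λ e → *-congˡ (proj₂ (G e) xs)) (eq x xs))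

  expand : ∀ {n f} → IsPolynomial (suc n) f →
    Σ (Fin q → Vec Carrier n → Carrier) λ g → (∀ e → IsPolynomial n (g e)) ×
      (∀ x xs → sum (λ e → x ^ toℕ e * g e xs) ≈ f (x ∷ xs))
  expand (F , eq) =
    (λ e → eval K (extendScalars {E = E} {K = K} ι λ es → F (e ∷ es))) ,
    (λ e → (λ es → F (e ∷ es)) , λ xs → refl) ,
    λ x xs → trans (sym (eval-∷ (extendScalars {E = E} {K = K} ι F) x xs)) (eq (x ∷ xs))

  poly-+ : ∀ {n f g} → IsPolynomial n f → IsPolynomial n g → IsPolynomial n (λ xs → f xs + g xs)
  poly-+ {zero} (F , F-eq) (G , G-eq) = (λ es → F es E.+ G es) , λ where
    [] → trans (*-congʳ (+-homo _ _)) (trans (distribʳ _ _ _) (+-cong (F-eq []) (G-eq [])))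
  poly-+ {suc n} {f} {g} P Q with f′ , F , f-eq ← expand P | g′ , G , g-eq ← expand Q =
    collect (λ e xs → f′ e xs + g′ e xs) (λ e → poly-+ (F e) (G e)) λ x xs → begin
      sum (λ e → x ^ toℕ e * (f′ e xs + g′ e xs))
        ≈⟨ sum-cong-≋ {q} (λ e → distribˡ (x ^ toℕ e) _ _) ⟩
      sum (λ e → x ^ toℕ e * f′ e xs + x ^ toℕ e * g′ e xs)
        ≈⟨ ∑-distrib-+ {q} (λ e → x ^ toℕ e * f′ e xs) _ ⟩
      sum (λ e → x ^ toℕ e * f′ e xs) + sum (λ e → x ^ toℕ e * g′ e xs)
        ≈⟨ +-cong (f-eq x xs) (g-eq x xs) ⟩
      f (x ∷ xs) + g (x ∷ xs) ∎

  -- These three are mutually recursive: a constant in `suc n` variables is a weakened constant,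
  -- weakening multiplies by the zeroth power of a new variable, and the other coefficients of that
  -- monomial are the constant 0 in `n` variables.
  poly-const : ∀ n a → IsPolynomial n (λ _ → ⟦ a ⟧)
  poly-monomial : ∀ n {f} (k : Fin q) → IsPolynomial n f →
    IsPolynomial (suc n) (λ xs → Vec.head xs ^ toℕ k * f (Vec.tail xs))
  poly-weaken : ∀ n {f} → IsPolynomial n f → IsPolynomial (suc n) (f ∘ Vec.tail)

  poly-const zero    a = (λ _ → a) , λ { [] → *-identityʳ _ }
  poly-const (suc n) a = poly-weaken n (poly-const n a)

  poly-monomial n {f} k F = collect g G λ x xs → begin
    sum (λ e → x ^ toℕ e * g e xs)  ≈⟨ sum-single _ k (λ e e≢k → trans (*-congˡ (g-≢ e≢k xs)) (zeroʳ (x ^ toℕ e))) ⟩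
    x ^ toℕ k * g k xs              ≈⟨ *-congˡ (g-≡ xs) ⟩
    x ^ toℕ k * f xs                ∎
    where
    g : Fin q → Vec Carrier n → Carrier
    g e with e Fin.≟ k
    ... | yes _ = f
    ... | no  _ = λ _ → ⟦ E.0# ⟧

    G : ∀ e → IsPolynomial n (g e)
    G e with e Fin.≟ k
    ... | yes _ = F
    ... | no  _ = poly-const n E.0#

    g-≡ : ∀ xs → g k xs ≈ f xs
    g-≡ xs with k Fin.≟ k
    ... | yes _   = refl
    ... | no  k≢k = contradiction ≡.refl k≢k

    g-≢ : ∀ {e} → e ≢ k → ∀ xs → g e xs ≈ 0#
    g-≢ {e} e≢k xs with e Fin.≟ k
    ... | yes e≡k = contradiction e≡k e≢k
    ... | no  _   = 0#-homo

  poly-weaken n F = poly-cong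
    (λ xs → trans (*-congʳ (^-congʳ (Vec.head xs) (Fin.toℕ-fromℕ< 0<q))) (*-identityˡ _))
    (poly-monomial n (fromℕ< 0<q) F)
    where
    0<q : 0 < q
    0<q = ℕ.<-trans (s≤s z≤n) 2<q

  poly-0 : ∀ n → IsPolynomial n (λ _ → 0#)
  poly-0 n = poly-cong (λ _ → 0#-homo) (poly-const n E.0#)

  poly-1 : ∀ n → IsPolynomial n (λ _ → 1#)
  poly-1 n = poly-cong (λ _ → 1#-homo) (poly-const n E.1#)

  poly-sum : ∀ {n m} {f : Fin m → Vec Carrier n → Carrier} →
    (∀ i → IsPolynomial n (f i)) → IsPolynomial n (λ xs → sum λ i → f i xs)
  poly-sum {n} {zero}  P = poly-0 n
  poly-sum {n} {suc m} P = poly-+ (P zero) (poly-sum (P ∘ suc))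

  -- The reduction modulo x ^ q - x takes place here: raising the exponent is harmless unless it
  -- reaches q, and then x ^ q = x brings it back to 1.
  poly-monomial⁺ : ∀ n {f} (e : Fin q) → IsPolynomial n f →
    IsPolynomial (suc n) (λ xs → Vec.head xs ^ suc (toℕ e) * f (Vec.tail xs))
  poly-monomial⁺ n e F with suc (toℕ e) ℕ.<? q
  ... | yes 1+e<q = poly-cong
    (λ xs → *-congʳ (^-congʳ (Vec.head xs) (Fin.toℕ-fromℕ< 1+e<q)))
    (poly-monomial n (fromℕ< 1+e<q) F)
  ... | no  1+e≮q = poly-cong
    (λ xs → *-congʳ (wrap (Vec.head xs)))
    (poly-monomial n (fromℕ< 1<q) F)
    where
    1<q : 1 < q
    1<q = ℕ.<-trans (s≤s (s≤s z≤n)) 2<q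

    1+e≡1+N : suc (toℕ e) ≡ suc N
    1+e≡1+N = ≡.trans (ℕ.≤-antisym (Fin.toℕ<n e) (ℕ.≮⇒≥ 1+e≮q)) q≡1+N

    wrap : ∀ x → x ^ toℕ (fromℕ< 1<q) ≈ x ^ suc (toℕ e)
    wrap x = begin
      x ^ toℕ (fromℕ< 1<q)  ≈⟨ ^-congʳ x (Fin.toℕ-fromℕ< 1<q) ⟩
      x ^ 1                 ≈⟨ *-identityʳ x ⟩
      x                     ≈⟨ x^[1+N]≈x x ⟨
      x ^ suc N             ≈⟨ ^-congʳ x 1+e≡1+N ⟨
      x ^ suc (toℕ e)       ∎

  poly-head* : ∀ {n f} → IsPolynomial (suc n) f → IsPolynomial (suc n) (λ xs → Vec.head xs * f xs)
  poly-head* {n} {f} P with g , G , g-eq ← expand P = poly-cong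
    (λ { (x ∷ xs) → begin
      sum (λ e → x ^ suc (toℕ e) * g e xs)  ≈⟨ sum-cong-≋ {q} (λ e → *-assoc x (x ^ toℕ e) (g e xs)) ⟩
      sum (λ e → x * (x ^ toℕ e * g e xs))  ≈⟨ *-distribˡ-sum {q} x (λ e → x ^ toℕ e * g e xs) ⟨
      x * sum (λ e → x ^ toℕ e * g e xs)    ≈⟨ *-congˡ (g-eq x xs) ⟩
      x * f (x ∷ xs)                        ∎ })
    (poly-sum λ e → poly-monomial⁺ n e (G e))

  poly-head^* : ∀ {n f} k → IsPolynomial (suc n) f → IsPolynomial (suc n) (λ xs → Vec.head xs ^ k * f xs)
  poly-head^* zero    P = poly-cong (λ xs → sym (*-identityˡ _)) P
  poly-head^* (suc k) P = poly-cong (λ xs → sym (*-assoc _ _ _)) (poly-head* (poly-head^* k P))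

  -- Only the first factor is expanded in powers of the first variable. Its coefficients are free of
  -- that variable, so they multiply `g` coefficientwise by induction; the powers follow through
  -- `poly-head^*`.
  poly-* : ∀ {n f g} → IsPolynomial n f → IsPolynomial n g → IsPolynomial n (λ xs → f xs * g xs)
  poly-* {zero} (F , F-eq) (G , G-eq) = (λ es → F es E.* G es) , λ where
    [] → trans (*-identityʳ _) (trans (*-homo _ _)
           (*-cong (trans (sym (*-identityʳ _)) (F-eq [])) (trans (sym (*-identityʳ _)) (G-eq []))))
  poly-* {suc n} {f} {g} P Q with f′ , F , f-eq ← expand P | g′ , G , g-eq ← expand Q =
    poly-cong
      (λ { (x ∷ xs) → begin
        sum (λ e → x ^ toℕ e * (f′ e xs * g (x ∷ xs)))  ≈⟨ sum-cong-≋ {q} (λ e → *-assoc (x ^ toℕ e) (f′ e xs) _) ⟨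
        sum (λ e → x ^ toℕ e * f′ e xs * g (x ∷ xs))    ≈⟨ *-distribʳ-sum {q} (g (x ∷ xs)) _ ⟨
        sum (λ e → x ^ toℕ e * f′ e xs) * g (x ∷ xs)    ≈⟨ *-congʳ (f-eq x xs) ⟩
        f (x ∷ xs) * g (x ∷ xs)                         ∎ })
      (poly-sum λ e → poly-head^* (toℕ e) (termwise e))
    where
    termwise : ∀ e → IsPolynomial (suc n) (λ xs → f′ e (Vec.tail xs) * g xs)
    termwise e = collect (λ j xs → f′ e xs * g′ j xs) (λ j → poly-* (F e) (G j)) λ x xs → begin
      sum (λ j → x ^ toℕ j * (f′ e xs * g′ j xs))  ≈⟨ sum-cong-≋ {q} (λ j → *-swap (x ^ toℕ j) (f′ e xs) _) ⟩
      sum (λ j → f′ e xs * (x ^ toℕ j * g′ j xs))  ≈⟨ *-distribˡ-sum {q} (f′ e xs) _ ⟨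
      f′ e xs * sum (λ j → x ^ toℕ j * g′ j xs)    ≈⟨ *-congˡ (g-eq x xs) ⟩
      f′ e xs * g (x ∷ xs)                         ∎

  poly-head : ∀ n → IsPolynomial (suc n) Vec.head
  poly-head n = poly-cong (λ xs → *-identityʳ _) (poly-head* (poly-1 (suc n)))

  poly-neg : ∀ {n f} → IsPolynomial n f → IsPolynomial n (λ xs → - f xs)
  poly-neg {n} P = poly-cong
    (λ xs → trans (*-congʳ (trans (-‿homo _) (-‿cong 1#-homo))) (-1*x≈-x _))
    (poly-* (poly-const n (E.- E.1#)) P)

  poly-^ : ∀ {n f} k → IsPolynomial n f → IsPolynomial n (λ xs → f xs ^ k)
  poly-^ {n} zero    P = poly-1 n
  poly-^     (suc k) P = poly-* P (poly-^ k P)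

  poly-δ : ∀ {n f} → IsPolynomial n f → IsPolynomial n (δ ∘ f)
  poly-δ {n} P = poly-+ (poly-1 n) (poly-neg (poly-^ N P))

-- The transposition of 0 and 1 and its effect on sums.

2IsNonZero 3IsNonZero : ∀ {c ℓ q} → FiniteField c ℓ q → Set ℓ
2IsNonZero K = ¬ (1# + 1# ≈ 0#)
  where open FiniteField K
3IsNonZero K = ¬ (1# + (1# + 1#) ≈ 0#)
  where open FiniteField K

module Swap {c ℓ q} (K : FiniteField c ℓ q) (2<q : 2 < q)
  (2≉0 : 2IsNonZero K) (3≉0 : 3IsNonZero K) where
  open Coefficients K 2<q public

  bijective-cong : ∀ {φ ψ} → (∀ x → φ x ≈ ψ x) → Bijective _≈_ _≈_ φ → Bijective _≈_ _≈_ ψ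
  bijective-cong φ≈ψ (injective , surjective) =
    (λ eq → injective (trans (φ≈ψ _) (trans eq (sym (φ≈ψ _))))) ,
    (λ y → proj₁ (surjective y) , λ eq → trans (sym (φ≈ψ _)) (proj₂ (surjective y) eq))

  bijective-∘ : ∀ {φ ψ} → Bijective _≈_ _≈_ φ → Bijective _≈_ _≈_ ψ → Bijective _≈_ _≈_ (ψ ∘ φ)
  bijective-∘ = Composition.bijective _≈_ _≈_ _≈_

  involution⇒bijective : ∀ {φ} → Congruent _≈_ _≈_ φ → (∀ x → φ (φ x) ≈ x) → Bijective _≈_ _≈_ φ
  involution⇒bijective φ-cong φφ = strictlyInverse⇒bijective φ-cong φ-cong φφ φφ

  -x≈y⇒x+y≈0 : ∀ {x y} → - x ≈ y → x + y ≈ 0#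
  -x≈y⇒x+y≈0 {x} eq = trans (+-congˡ (sym eq)) (-‿inverseʳ x)

  -- This and the next three inequalities place - 1 and - 2 outside {0, 1}, so that τ fixes them; -
  -- 1 ≠ 1 comes from 2 ≠ 0, and - 2 ≠ 1 from 3 ≠ 0.
  -1≉0 : ¬ (- 1# ≈ 0#)
  -1≉0 eq = 0≉1 (sym (trans (sym (+-identityʳ 1#)) (-x≈y⇒x+y≈0 eq)))

  -1≉1 : ¬ (- 1# ≈ 1#)
  -1≉1 = 2≉0 ∘ -x≈y⇒x+y≈0

  -2≉0 : ¬ (- (1# + 1#) ≈ 0#)
  -2≉0 eq = 2≉0 (trans (sym (+-identityʳ _)) (-x≈y⇒x+y≈0 eq))

  -2≉1 : ¬ (- (1# + 1#) ≈ 1#)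
  -2≉1 eq = 3≉0 (trans (+-comm _ _) (-x≈y⇒x+y≈0 eq))

  γ : Carrier → Carrier
  γ x = δ x - δ (x - 1#)

  γ-cong : Congruent _≈_ _≈_ γ
  γ-cong eq = +-cong (δ-cong eq) (-‿cong (δ-cong (+-congʳ eq)))

  γ-0 : ∀ {x} → x ≈ 0# → γ x ≈ 1#
  γ-0 {x} x≈0 = trans
    (+-cong (δ-0 x≈0) (-‿cong (δ-≉0 λ eq → 0≉1 (trans (sym x≈0) (x-y≈0⇒x≈y eq)))))
    (x-0≈x 1#)

  γ-1 : ∀ {x} → x ≈ 1# → γ x ≈ - 1#
  γ-1 {x} x≈1 = trans
    (+-cong (δ-≉0 λ x≈0 → 0≉1 (trans (sym x≈0) x≈1)) (-‿cong (δ-0 (x≈y⇒x∙y⁻¹≈ε x≈1))))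
    (+-identityˡ _)

  γ-other : ∀ {x} → ¬ (x ≈ 0#) → ¬ (x ≈ 1#) → γ x ≈ 0#
  γ-other x≉0 x≉1 = trans (+-cong (δ-≉0 x≉0) (-‿cong (δ-≉0 (x≉1 ∘ x-y≈0⇒x≈y)))) (-‿inverseʳ 0#)

  ∑-γ : ∀ f → Congruent _≈_ _≈_ f → ∑ (λ x → f x * γ x) ≈ f 0# - f 1#
  ∑-γ f f-cong = begin
    ∑ (λ x → f x * (δ x - δ (x - 1#)))
      ≈⟨ sum-cong-≋ {q} (λ i → x[y-z]≈xy-xz (f (element i)) (δ (element i)) (δ (element i - 1#))) ⟩
    ∑ (λ x → f x * δ x - f x * δ (x - 1#))
      ≈⟨ ∑-distrib-+ {q} (λ i → f (element i) * δ (element i)) (λ i → - (f (element i) * δ (element i - 1#))) ⟩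
    ∑ (λ x → f x * δ x) + ∑ (λ x → - (f x * δ (x - 1#)))
      ≈⟨ +-cong (∑-δ₀ f f-cong) (trans (∑-neg λ x → f x * δ (x - 1#)) (-‿cong (∑-δ f 1# f-cong))) ⟩
    f 0# - f 1# ∎

  τ : Carrier → Carrier
  τ x = x + γ x

  τ-cong : Congruent _≈_ _≈_ τ
  τ-cong eq = +-cong eq (γ-cong eq)

  τ-0 : ∀ {x} → x ≈ 0# → τ x ≈ 1#
  τ-0 x≈0 = trans (+-cong x≈0 (γ-0 x≈0)) (+-identityˡ 1#)

  τ-1 : ∀ {x} → x ≈ 1# → τ x ≈ 0#
  τ-1 x≈1 = trans (+-cong x≈1 (γ-1 x≈1)) (-‿inverseʳ 1#)

  τ-other : ∀ {x} → ¬ (x ≈ 0#) → ¬ (x ≈ 1#) → τ x ≈ x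
  τ-other x≉0 x≉1 = trans (+-congˡ (γ-other x≉0 x≉1)) (+-identityʳ _)

  τ-involutive : ∀ x → τ (τ x) ≈ x
  τ-involutive x with x ≟ 0# | x ≟ 1#
  ... | yes x≈0 | _       = trans (τ-1 (τ-0 x≈0)) (sym x≈0)
  ... | no  _   | yes x≈1 = trans (τ-0 (τ-1 x≈1)) (sym x≈1)
  ... | no  x≉0 | no  x≉1 = trans (τ-cong (τ-other x≉0 x≉1)) (τ-other x≉0 x≉1)

  τ-bijective : Bijective _≈_ _≈_ τ
  τ-bijective = involution⇒bijective τ-cong τ-involutive

  -- The sign makes `reflect u` an involution, so that y = τ (reflect u z) inverts z = reflect u (τ
  -- y).
  reflect : Carrier → Carrier → Carrier
  reflect u x = - (x + u)

  reflect-cong : ∀ {u v x y} → u ≈ v → x ≈ y → reflect u x ≈ reflect v y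
  reflect-cong u≈v x≈y = -‿cong (+-cong x≈y u≈v)

  reflect-involutive : ∀ u x → reflect u (reflect u x) ≈ x
  reflect-involutive u x = begin
    - (- (x + u) + u)      ≈⟨ -‿cong (+-congʳ (-‿+-comm x u)) ⟨
    - (- x + - u + u)      ≈⟨ -‿cong (x-y+y≈x (- x) u) ⟩
    - - x                  ≈⟨ -‿involutive x ⟩
    x                      ∎

  reflect-bijective : ∀ u → Bijective _≈_ _≈_ (reflect u)
  reflect-bijective u = involution⇒bijective (reflect-cong refl) (reflect-involutive u)

  κ : Carrier → Carrier
  κ u = τ (reflect u 0#) - τ (reflect u 1#)

  κ-cong : Congruent _≈_ _≈_ κ
  κ-cong eq = +-cong (τ-cong (reflect-cong eq refl)) (-‿cong (τ-cong (reflect-cong eq refl)))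

  -- τ sends 0 to 1 and fixes - 1, so the difference is 1 - (- 1).
  κ-0 : ∀ {u} → u ≈ 0# → κ u ≈ 1# + 1#
  κ-0 {u} u≈0 = +-cong
    (τ-0 (trans (-‿cong (trans (+-identityˡ u) u≈0)) -0#≈0#))
    (trans (-‿cong (trans (τ-cong -[1+u]≈-1) (τ-other -1≉0 -1≉1))) (-‿involutive 1#))
    where
    -[1+u]≈-1 : - (1# + u) ≈ - 1#
    -[1+u]≈-1 = -‿cong (trans (+-congˡ u≈0) (+-identityʳ 1#))

  -- τ fixes both - 1 and - 2, so the difference is - 1 + 2.
  κ-1 : ∀ {u} → u ≈ 1# → κ u ≈ 1#
  κ-1 {u} u≈1 = begin
    τ (- (0# + u)) - τ (- (1# + u))
      ≈⟨ +-cong (trans (τ-cong (-‿cong (trans (+-identityˡ u) u≈1))) (τ-other -1≉0 -1≉1))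
                (-‿cong (trans (τ-cong (-‿cong (+-congˡ u≈1))) (τ-other -2≉0 -2≉1))) ⟩
    - 1# - - (1# + 1#)     ≈⟨ +-congˡ (-‿involutive _) ⟩
    - 1# + (1# + 1#)       ≈⟨ +-assoc _ _ _ ⟨
    - 1# + 1# + 1#         ≈⟨ +-congʳ (-‿inverseˡ 1#) ⟩
    0# + 1#                ≈⟨ +-identityˡ 1# ⟩
    1#                     ∎

  -- κ takes the values 2 at 0 and 1 at 1. Exchanging them changes κ by - 1 at 0 and by 1 at 1,
  -- which is - γ; all other points are fixed by τ.
  κ-τ : ∀ u → κ (τ u) ≈ κ u - γ u
  κ-τ u with u ≟ 0# | u ≟ 1#
  ... | yes u≈0 | _       = trans (κ-1 (τ-0 u≈0))
    (sym (trans (+-cong (κ-0 u≈0) (-‿cong (γ-0 u≈0))) (x+y-y≈x 1# 1#)))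
  ... | no  _   | yes u≈1 = trans (κ-0 (τ-1 u≈1))
    (sym (+-cong (κ-1 u≈1) (trans (-‿cong (γ-1 u≈1)) (-‿involutive 1#))))
  ... | no  u≉0 | no  u≉1 = trans (κ-cong (τ-other u≉0 u≉1))
    (sym (trans (+-congˡ (-‿cong (γ-other u≉0 u≉1))) (x-0≈x _)))

  -- Substitute y = τ (reflect u z).
  ∑-γ-reflect-τ : ∀ u → ∑ (λ y → - y * γ (reflect u (τ y))) ≈ - κ u
  ∑-γ-reflect-τ u = begin
    ∑ (λ y → - y * γ (reflect u (τ y)))
      ≈⟨ sum-cong-≋ {q} (λ i → *-congʳ (-‿cong (invert (element i)))) ⟨
    ∑ (λ y → h (reflect u (τ y)))
      ≈⟨ ∑-reindex {h = h} (bijective-∘ τ-bijective (reflect-bijective u)) h-cong ⟩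
    ∑ (λ z → - τ (reflect u z) * γ z)
      ≈⟨ ∑-γ (λ z → - τ (reflect u z)) (-‿cong ∘ τ-cong ∘ reflect-cong refl) ⟩
    - τ (reflect u 0#) - - τ (reflect u 1#)
      ≈⟨ -‿+-comm _ _ ⟩
    - κ u ∎
    where
    h : Carrier → Carrier
    h z = - τ (reflect u z) * γ z

    h-cong : Congruent _≈_ _≈_ h
    h-cong eq = *-cong (-‿cong (τ-cong (reflect-cong refl eq))) (γ-cong eq)

    invert : ∀ y → τ (reflect u (reflect u (τ y))) ≈ y
    invert y = trans (τ-cong (reflect-involutive u (τ y))) (τ-involutive y)

-- The inductive construction of local permutations, and their degree.

sum-map-replicate : ∀ {A : Set} (f : A → ℕ) n x → Vec.sum (Vec.map f (Vec.replicate n x)) ≡ n ℕ.* f x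
sum-map-replicate f zero    x = ≡.refl
sum-map-replicate f (suc n) x = ≡.cong (f x ℕ.+_) (sum-map-replicate f n x)

sum-map-≤ : ∀ {A : Set} {n} (f : A → ℕ) (xs : Vec A n) {b} →
  (∀ i → f (Vec.lookup xs i) ≤ b) → Vec.sum (Vec.map f xs) ≤ n ℕ.* b
sum-map-≤ f []       bound = z≤n
sum-map-≤ f (x ∷ xs) bound = ℕ.+-mono-≤ (bound zero) (sum-map-≤ f xs (bound ∘ suc))

module Construction {c₁ ℓ₁ c₂ ℓ₂ p q} (E : FiniteField c₁ ℓ₁ p) (K : FiniteField c₂ ℓ₂ q) (2<q : 2 < q)
  (ι : Embedding E K)
  (2≉0 : 2IsNonZero K) (3≉0 : 3IsNonZero K) where
  open Swap K 2<q 2≉0 3≉0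
  open PolynomialFunctions E K 2<q ι

  q-2<q : q ∸ 2 < q
  q-2<q = ℕ.∸-monoʳ-< (s≤s z≤n) (ℕ.<⇒≤ 2<q)

  e* : ∀ n → Exponents q n
  e* n = Vec.replicate n (fromℕ< q-2<q)

  -- `leading n (h ∘ f)` is Tₙ h for the local permutation f.
  leading : ∀ n → (Vec Carrier n → Carrier) → Carrier
  leading n = coefficient (e* n)

  poly-τ : ∀ {n f} → IsPolynomial n f → IsPolynomial n (τ ∘ f)
  poly-τ {n} P = poly-+ P (poly-+ (poly-δ P) (poly-neg (poly-δ (poly-+ P (poly-neg (poly-1 n))))))

  LocallyBijective : ∀ n → (Vec Carrier n → Carrier) → Set (c₂ ⊔ ℓ₂)
  LocallyBijective n f = ∀ i a → Bijective _≈_ _≈_ λ t → f (a [ i ]≔ t)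

  -- The invariant concerns `γ ∘ function` because the recursion controls that coefficient; the
  -- coefficient of a permutation itself is settled only in `maximal`.
  record Candidate n : Set (c₁ ⊔ c₂ ⊔ ℓ₂) where
    field
      function         : Vec Carrier n → Carrier
      isPolynomial     : IsPolynomial n function
      locallyBijective : LocallyBijective n function
      leading-γ≉0      : ¬ (leading n (γ ∘ function) ≈ 0#)

  leading-∷ : ∀ n f → leading (suc n) f ≈ leading n λ xs → ∑ λ y → - y * f (y ∷ xs)
  leading-∷ n f = trans (coefficient-∷ (fromℕ< q-2<q) (e* n) f) (coefficient-cong (e* n) λ xs →
    sum-cong-≋ {q} λ i → *-congʳ (trans
      (reflexive (≡.cong (λ k → dual k (element i)) (Fin.toℕ-fromℕ< q-2<q)))
      (dual-[q-2] (element i))))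

  join : ∀ {n} → (Vec Carrier n → Carrier) → Vec Carrier (suc n) → Carrier
  join f xs = reflect (f (Vec.tail xs)) (τ (Vec.head xs))

  -- The sum inside `join` is symmetric in its two terms: with either one fixed, the other is a
  -- bijection followed by a reflection.
  join-locallyBijective : ∀ {n} f → LocallyBijective n f → LocallyBijective (suc n) (join f)
  join-locallyBijective f bij zero    (x ∷ xs) = bijective-∘ τ-bijective (reflect-bijective (f xs))
  join-locallyBijective f bij (suc i) (x ∷ xs) = bijective-cong
    (λ t → -‿cong (+-comm (f (xs [ i ]≔ t)) (τ x)))
    (bijective-∘ (bij i xs) (reflect-bijective (τ x)))

  leading-γ-join : ∀ n f → leading (suc n) (γ ∘ join f) ≈ - leading n (κ ∘ f)
  leading-γ-join n f = begin
    leading (suc n) (γ ∘ join f)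
      ≈⟨ leading-∷ n (γ ∘ join f) ⟩
    leading n (λ xs → ∑ λ y → - y * γ (reflect (f xs) (τ y)))
      ≈⟨ coefficient-cong (e* n) (λ xs → ∑-γ-reflect-τ (f xs)) ⟩
    leading n (λ xs → - κ (f xs))
      ≈⟨ coefficient-neg (e* n) (κ ∘ f) ⟩
    - leading n (κ ∘ f) ∎

  extend : ∀ {n f} → IsPolynomial n f → LocallyBijective n f → ¬ (leading n (κ ∘ f) ≈ 0#) → Candidate (suc n)
  extend {n} {f} P bij ≉0 = record
    { function         = join f
    ; isPolynomial     = poly-neg (poly-+ (poly-τ (poly-head n)) (poly-weaken n P))
    ; locallyBijective = join-locallyBijective f bij
    ; leading-γ≉0      = λ eq → ≉0 (-‿injective (trans (sym (leading-γ-join n f)) (trans eq (sym -0#≈0#))))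
    }

  τ∘-locallyBijective : ∀ {n} f → LocallyBijective n f → LocallyBijective n (τ ∘ f)
  τ∘-locallyBijective f bij i a = bijective-∘ (bij i a) τ-bijective

  candidate : ∀ n → Candidate n
  candidate zero = record
    { function         = λ _ → 0#
    ; isPolynomial     = poly-0 0
    ; locallyBijective = λ ()
    -- Without variables `leading` is evaluation, and γ 0 = 1.
    ; leading-γ≉0      = λ eq → 0≉1 (trans (sym eq) (γ-0 refl))
    }
  candidate (suc n) with leading n (κ ∘ Candidate.function (candidate n)) ≟ 0#
  ... | no  ≉0 = extend isPolynomial locallyBijective ≉0
    where open Candidate (candidate n)
  -- The choice σ = id fails, so σ = τ is taken: if it failed too, κ ∘ τ = κ - γ would make the
  -- coefficient of `γ ∘ f` vanish.
  ... | yes κ≈0 = extend (poly-τ isPolynomial) (τ∘-locallyBijective f locallyBijective) λ κτ≈0 →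
    leading-γ≉0 (-‿injective (begin
      - leading n (γ ∘ f)                           ≈⟨ +-identityˡ _ ⟨
      0# - leading n (γ ∘ f)                        ≈⟨ +-cong κ≈0 (coefficient-neg (e* n) (γ ∘ f)) ⟨
      leading n (κ ∘ f) + leading n (λ xs → - γ (f xs))  ≈⟨ coefficient-+ (e* n) (κ ∘ f) (λ xs → - γ (f xs)) ⟨
      leading n (λ xs → κ (f xs) - γ (f xs))        ≈⟨ coefficient-cong (e* n) (λ xs → κ-τ (f xs)) ⟨
      leading n (κ ∘ τ ∘ f)                         ≈⟨ κτ≈0 ⟩
      0#                                            ≈⟨ -0#≈0# ⟨
      - 0#                                          ∎))
    where
    open Candidate (candidate n) renaming (function to f)

  maximal : ∀ n → Σ (Vec Carrier n → Carrier) λ f →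
    IsPolynomial n f × LocallyBijective n f × ¬ (leading n f ≈ 0#)
  maximal n with leading n (Candidate.function (candidate n)) ≟ 0#
  ... | no  ≉0  = function , isPolynomial , locallyBijective , ≉0
    where open Candidate (candidate n)
  -- By definition `τ ∘ f` is the sum of `f` and `γ ∘ f`, and only the latter has a non-zero leading
  -- coefficient.
  ... | yes f≈0 = τ ∘ f , poly-τ isPolynomial , τ∘-locallyBijective f locallyBijective , λ τf≈0 →
    leading-γ≉0 (begin
      leading n (γ ∘ f)                    ≈⟨ +-identityˡ _ ⟨
      0# + leading n (γ ∘ f)               ≈⟨ +-congʳ f≈0 ⟨
      leading n f + leading n (γ ∘ f)      ≈⟨ coefficient-+ (e* n) f (γ ∘ f) ⟨
      leading n (τ ∘ f)                    ≈⟨ τf≈0 ⟩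
      0#                                   ∎)
    where
    open Candidate (candidate n) renaming (function to f)

  -- Along each coordinate line the values run through the whole field and sum to 0, because 1 < N.
  -- So no exponent equals N = q - 1 in a monomial that occurs, and each is at most q - 2.
  degree≤ : ∀ {n} (F : ReducedPoly K q n) → IsLocalPermutation K F →
    ∀ e → ¬ (F e ≈ 0#) → totalDegree e ≤ n ℕ.* (q ∸ 2)
  degree≤ F bij e Fe≉0 = sum-map-≤ toℕ e λ i → bound i
    where
    ∑-x≈0 : ∑ id ≈ 0#
    ∑-x≈0 = trans (sum-cong-≋ {q} λ i → sym (*-identityʳ (element i))) (∑-^ 1<N)

    q-2≡pred[N] : pred N ≡ q ∸ 2
    q-2≡pred[N] = ℕ.∸-+-assoc q 1 1

    bound : ∀ i → toℕ (Vec.lookup e i) ≤ q ∸ 2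
    bound i with toℕ (Vec.lookup e i) ℕ.≟ N
    ... | yes eᵢ≡N = contradiction
      (trans (sym (coefficient-eval F e)) (coefficient-vanishes e (eval K F) i eᵢ≡N
        λ xs → trans (∑-reindex {h = id} (bij i xs) id) ∑-x≈0))
      Fe≉0
    ... | no  eᵢ≢N = ℕ.≤-trans (ℕ.<⇒≤pred (ℕ.≤∧≢⇒< (toℕ≤N (Vec.lookup e i)) eᵢ≢N)) (ℕ.≤-reflexive q-2≡pred[N])

  localPermutationPolynomial : ∀ n → Σ (ReducedPoly E q n) λ F →
    IsLocalPermutation K (extendScalars {E = E} {K = K} ι F) ×
    HasDegree K (extendScalars {E = E} {K = K} ι F) (n ℕ.* (q ∸ 2))
  localPermutationPolynomial n with f , (F , eq) , bij , ≉0 ← maximal n =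
    F , local , (e* n , nonzero , degree) , degree≤ _ local
    where
    ιF : ReducedPoly K q n
    ιF = extendScalars {E = E} {K = K} ι F

    local : IsLocalPermutation K ιF
    local i a = bijective-cong (λ t → sym (eq (a [ i ]≔ t))) (bij i a)

    nonzero : ¬ (ιF (e* n) ≈ 0#)
    nonzero Fe≈0 = ≉0 (begin
      leading n f             ≈⟨ coefficient-cong (e* n) eq ⟨
      leading n (eval K ιF)   ≈⟨ coefficient-eval ιF (e* n) ⟩
      ιF (e* n)               ≈⟨ Fe≈0 ⟩
      0#                      ∎)

    degree : totalDegree (e* n) ≡ n ℕ.* (q ∸ 2)
    degree = ≡.trans (sum-map-replicate toℕ n (fromℕ< q-2<q)) (≡.cong (n ℕ.*_) (Fin.toℕ-fromℕ< q-2<q))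

-- Small multiples of 1 in the prime field and their images in the extension.

module Characteristic {c ℓ p} (E : FiniteField c ℓ p) (p-prime : Prime p) where
  open FieldProperties E
  open SemiringMult semiring using (×1-homo-*) renaming (_×_ to _·_)

  -- p · 1 is the sum of 1 over all p elements.
  p·1≈0 : p · 1# ≈ 0#
  p·1≈0 = trans (sym (sum-replicate p)) ∑-1

  multiple·1≈0 : ∀ {m} k → m · 1# ≈ 0# → (k ℕ.* m) · 1# ≈ 0#
  multiple·1≈0 {m} k m≈0 = trans (×1-homo-* k m) (trans (*-congˡ m≈0) (zeroʳ _))

  consecutive⇒1≈0 : ∀ {a b} → 1 ℕ.+ a ≡ b → a · 1# ≈ 0# → b · 1# ≈ 0# → 1# ≈ 0#
  consecutive⇒1≈0 ≡.refl a≈0 b≈0 = trans (sym (trans (+-congˡ a≈0) (+-identityʳ 1#))) b≈0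

  -- By Bézout some multiples of m and p differ by 1; if m · 1 = 0, both would annihilate 1 and
  -- force 1 = 0.
  m·1≉0 : ∀ {m} → .{{ℕ.NonZero m}} → m < p → ¬ (m · 1# ≈ 0#)
  m·1≉0 {m} m<p m≈0 with coprime-Bézout (prime⇒coprime p-prime m<p)
  ... | Bézout.+- x y eq = 0≉1 (sym (consecutive⇒1≈0 {y ℕ.* m} eq (multiple·1≈0 y m≈0) (multiple·1≈0 x p·1≈0)))
  ... | Bézout.-+ x y eq = 0≉1 (sym (consecutive⇒1≈0 {x ℕ.* p} eq (multiple·1≈0 x p·1≈0) (multiple·1≈0 y m≈0)))

module EmbeddingProperties {c₁ ℓ₁ c₂ ℓ₂ p q} {E : FiniteField c₁ ℓ₁ p} {K : FiniteField c₂ ℓ₂ q}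
  (ι : Embedding E K) where
  private module E = FiniteField E
  open FieldProperties K
  open Embedding ι
  open RingMorphisms E.rawRing rawRing using (IsRingHomomorphism)
  open IsRingHomomorphism isRingHomomorphism using (⟦⟧-cong; *-homo; 1#-homo)

  -- A homomorphism preserves x y = 1, so the image of x has an inverse.
  ⟦⟧-≉0 : ∀ {x} → ¬ (x E.≈ E.0#) → ¬ (⟦ x ⟧ ≈ 0#)
  ⟦⟧-≉0 {x} x≉0 ⟦x⟧≈0 with y , xy≈1 ← E.inverse x x≉0 = 0≉1 (begin
    0#              ≈⟨ zeroˡ ⟦ y ⟧ ⟨
    0# * ⟦ y ⟧      ≈⟨ *-congʳ ⟦x⟧≈0 ⟨
    ⟦ x ⟧ * ⟦ y ⟧   ≈⟨ *-homo x y ⟨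
    ⟦ x E.* y ⟧     ≈⟨ ⟦⟧-cong xy≈1 ⟩
    ⟦ E.1# ⟧        ≈⟨ 1#-homo ⟩
    1#              ∎)

-- What the conditions on `b` imply for p and q, and the theorem.

open import Data.Nat using (_*_; _^_)

mainTheorem11 : ∀ {c₁ ℓ₁ c₂ ℓ₂} (p r q : ℕ) → Prime p → q ≡ p ^ r →
    (𝔽p : FiniteField c₁ ℓ₁ p) (𝔽q : FiniteField c₂ ℓ₂ q) (ι : Embedding 𝔽p 𝔽q) →
    (b : ℕ) → 1 < b → b < p ∸ 1 → gcd b (q ∸ 1) ≡ 1 →
    (n : ℕ) → 1 ≤ n →
    Σ (ReducedPoly 𝔽p q n) λ F →
    IsLocalPermutation 𝔽q (extendScalars ι F) ×
    HasDegree 𝔽q (extendScalars ι F) (n * (q ∸ 2))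
mainTheorem11 p r q p-prime q≡p^r 𝔽p 𝔽q ι b 1<b b<p-1 gcd≡1 n _ =
  Construction.localPermutationPolynomial 𝔽p 𝔽q 2<q ι 2≉0 3≉0 n
  where
  open FieldProperties 𝔽q hiding (_*_; _^_)
  open Characteristic 𝔽p p-prime using (m·1≉0)
  open EmbeddingProperties ι
  module 𝔽p = FieldProperties 𝔽p
  open Embedding ι
  open RingMorphisms 𝔽p.rawRing rawRing using (IsRingHomomorphism)
  open IsRingHomomorphism isRingHomomorphism using (⟦⟧-cong; +-homo; 1#-homo)

  -- From 2 ≤ b and b + 1 ≤ p - 1.
  3<p : 3 < p
  3<p = suc≤ (ℕ.<-≤-trans (s≤s 1<b) b<p-1)
    where
    suc≤ : ∀ {m} → 3 ≤ m ∸ 1 → 3 < m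
    suc≤ {suc m} 3≤m = s≤s 3≤m

  2<q : 2 < q
  2<q = 2<p^k r q≡p^r
    where
    2<p^k : ∀ k → q ≡ p ^ k → 2 < q
    -- For r = 0 we would have q - 1 = 0, which b divides; then b divides the gcd, which is 1,
    -- against 1 < b.
    2<p^k zero    q≡1 = contradiction
      (∣1⇒≡1 (≡.subst (b ∣_) gcd≡1 (gcd-greatest ∣-refl (≡.subst (λ m → b ∣ m ∸ 1) (≡.sym q≡1) (b ∣0)))))
      (ℕ.>⇒≢ 1<b)
    2<p^k (suc k) q≡p*p^k = ≡.subst (2 <_) (≡.sym q≡p*p^k)
      (ℕ.<-≤-trans (ℕ.<-trans (ℕ.n<1+n 2) 3<p) (ℕ.m≤m*n p (p ^ k)))
      where
      instance
        _ = prime⇒nonZero p-prime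
        _ = ℕ.m^n≢0 p k

  2≉0 : ¬ (1# + 1# ≈ 0#)
  -- The multiple 2 · 1 unfolds with a trailing zero summand, which is removed before the embedding
  -- is applied termwise.
  2≉0 eq = ⟦⟧-≉0 (m·1≉0 {2} (ℕ.<-trans (ℕ.n<1+n 2) 3<p)) (begin
    ⟦ 𝔽p.1# 𝔽p.+ (𝔽p.1# 𝔽p.+ 𝔽p.0#) ⟧  ≈⟨ ⟦⟧-cong (𝔽p.+-congˡ (𝔽p.+-identityʳ _)) ⟩
    ⟦ 𝔽p.1# 𝔽p.+ 𝔽p.1# ⟧               ≈⟨ trans (+-homo _ _) (+-cong 1#-homo 1#-homo) ⟩
    1# + 1#                            ≈⟨ eq ⟩
    0#                                 ∎)

  3≉0 : ¬ (1# + (1# + 1#) ≈ 0#)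
  3≉0 eq = ⟦⟧-≉0 (m·1≉0 {3} 3<p) (begin
    ⟦ 𝔽p.1# 𝔽p.+ (𝔽p.1# 𝔽p.+ (𝔽p.1# 𝔽p.+ 𝔽p.0#)) ⟧  ≈⟨ ⟦⟧-cong (𝔽p.+-congˡ (𝔽p.+-congˡ (𝔽p.+-identityʳ _))) ⟩
    ⟦ 𝔽p.1# 𝔽p.+ (𝔽p.1# 𝔽p.+ 𝔽p.1#) ⟧               ≈⟨ trans (+-homo _ _) (+-cong 1#-homo (+-homo _ _)) ⟩
    1# + (⟦ 𝔽p.1# ⟧ + ⟦ 𝔽p.1# ⟧)                    ≈⟨ +-congˡ (+-cong 1#-homo 1#-homo) ⟩
    1# + (1# + 1#)                                  ≈⟨ eq ⟩
    0#                                              ∎)
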